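{- Let $n\ge 3$ be an integer with $n \equiv 0$ or $3 \pmod 4$, and let $H_n$ be the graph obtained from the complete graph $K_n$ by adding, for each pair $\{u,w\}$ of distinct vertices of $K_n$, a new vertex adjacent exactly to $u$ and $w$ (all edges of $K_n$ being kept). Then $\chi_{\mathsf{odd}}(H_n) = n$. In particular, since each $H_n$ is a split graph, the odd chromatic number is unbounded on split graphs, and hence on graphs with no induced path on five vertices ($P_5$-free graphs).
   Context: All graphs are finite, simple and undirected. A graph is called odd if every vertex has odd degree. $\chi_{\mathsf{odd}}(G)$, the odd chromatic number of $G$, is the minimum number of odd induced subgraphs of $G$ whose vertex sets partition $V(G)$. (By a theorem of Scott, such a partition exists if and only if every connected component of $G$ has even order.) A split graph is a graph whose vertex set can be partitioned into a clique and an independent set. -}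

module Defs where

open import Axiom.UniquenessOfIdentityProofs using (module Decidable⇒UIP)
open import Data.Bool using (Bool; true; false)
open import Data.Empty using (⊥)
open import Data.Fin using (Fin; toℕ) renaming (_<_ to _<ᶠ_)
open import Data.Fin.Properties using (<-irrelevant) renaming (_≟_ to _≟ᶠ_; _<?_ to _<ᶠ?_)
open import Data.List using (List; []; _∷_; _++_; map; filter; length; allFin; cartesianProduct)
open import Data.List.Membership.Propositional using (_∈_)
open import Data.List.Membership.Propositional.Properties using (∈-map⁺; ∈-map⁻; ∈-++⁺ˡ; ∈-++⁺ʳ; ∈-cartesianProduct⁺; ∈-allFin)
open import Data.List.Relation.Unary.All using (All; []; _∷_)
open import Data.List.Relation.Unary.AllPairs using ([]; _∷_)
open import Data.List.Relation.Unary.Any using (here; there)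
open import Data.List.Relation.Unary.Unique.Propositional using (Unique)
import Data.List.Relation.Unary.Unique.Propositional.Properties as Unique
open import Data.Nat using (ℕ; suc; _≤_; _%_) renaming (_≟_ to _≟ⁿ_)
open import Data.Nat.Properties using (1+n≢n)
open import Data.Product using (Σ; ∃; _×_; _,_; proj₁)
open import Data.Sum using (_⊎_; inj₁; inj₂; swap)
open import Data.Sum.Properties using (inj₁-injective; inj₂-injective)
open import Function.Bundles using (_⇔_)
open import Function.Definitions using (Injective; StrictlySurjective)
open import Level using (0ℓ)
open import Relation.Binary.Core using (Rel)
import Relation.Binary.Definitions as Binary
open import Relation.Binary.PropositionalEquality using (_≡_; _≢_; refl; cong; ≢-sym)
open import Relation.Nullary using (¬_; yes; no; contradiction)
open import Relation.Nullary.Decidable using (¬?; _⊎-dec_)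
open import Relation.Unary using (Pred; Decidable; Irrelevant)

record Finite (A : Set) : Set where
  field
    elements : List A
    unique   : Unique elements
    complete : ∀ x → x ∈ elements

module _ {A : Set} {P : Pred A 0ℓ} (P? : Decidable P) where

  restrict : List A → List (Σ A P)
  restrict []       = []
  restrict (x ∷ xs) with P? x
  ... | yes p = (x , p) ∷ restrict xs
  ... | no  _ = restrict xs

  restrict-≢ : ∀ {x} (p : P x) xs → All (x ≢_) xs → All ((x , p) ≢_) (restrict xs)
  restrict-≢ p []       []          = []
  restrict-≢ p (y ∷ xs) (x≢y ∷ x≢xs) with P? y
  ... | yes _ = (λ eq → x≢y (cong proj₁ eq)) ∷ restrict-≢ p xs x≢xs
  ... | no  _ = restrict-≢ p xs x≢xs

  restrict-unique : ∀ xs → Unique xs → Unique (restrict xs)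
  restrict-unique []       []        = []
  restrict-unique (x ∷ xs) (x≢ ∷ xs!) with P? x
  ... | yes p = restrict-≢ p xs x≢ ∷ restrict-unique xs xs!
  ... | no  _ = restrict-unique xs xs!

  restrict-∈ : Irrelevant P → ∀ {x} (p : P x) {xs} → x ∈ xs → (x , p) ∈ restrict xs
  restrict-∈ irr {x} p (here refl) with P? x
  ... | yes q = here (cong (x ,_) (irr p q))
  ... | no ¬p = contradiction p ¬p
  restrict-∈ irr p {y ∷ _} (there x∈xs) with P? y
  ... | yes _ = there (restrict-∈ irr p x∈xs)
  ... | no  _ = restrict-∈ irr p x∈xs

  Σ-finite : Irrelevant P → Finite A → Finite (Σ A P)
  Σ-finite irr fin = record
    { elements = restrict elements
    ; unique   = restrict-unique elements unique
    ; complete = λ (x , p) → restrict-∈ irr p (complete x)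
    }
    where open Finite fin

Fin-finite : ∀ n → Finite (Fin n)
Fin-finite n = record
  { elements = allFin n
  ; unique   = Unique.allFin⁺ n
  ; complete = ∈-allFin
  }

×-finite : ∀ {A B : Set} → Finite A → Finite B → Finite (A × B)
×-finite fa fb = record
  { elements = cartesianProduct A.elements B.elements
  ; unique   = Unique.cartesianProduct⁺ A.unique B.unique
  ; complete = λ (x , y) → ∈-cartesianProduct⁺ (A.complete x) (B.complete y)
  }
  where
  module A = Finite fa
  module B = Finite fb

⊎-finite : ∀ {A B : Set} → Finite A → Finite B → Finite (A ⊎ B)
⊎-finite {A} {B} fa fb = record
  { elements = map inj₁ A.elements ++ map inj₂ B.elements
  ; unique   = Unique.++⁺ (Unique.map⁺ inj₁-injective A.unique)
                          (Unique.map⁺ inj₂-injective B.unique)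
                          disjoint
  ; complete = λ where
      (inj₁ x) → ∈-++⁺ˡ (∈-map⁺ inj₁ (A.complete x))
      (inj₂ y) → ∈-++⁺ʳ (map inj₁ A.elements) (∈-map⁺ inj₂ (B.complete y))
  }
  where
  module A = Finite fa
  module B = Finite fb
  disjoint : ∀ {z : A ⊎ B} → ¬ (z ∈ map inj₁ A.elements × z ∈ map inj₂ B.elements)
  disjoint (p , q) with ∈-map⁻ inj₁ p | ∈-map⁻ inj₂ q
  ... | _ , _ , refl | _ , _ , ()

record Graph : Set₁ where
  field
    Vertex     : Set
    finite     : Finite Vertex
    Adj        : Rel Vertex 0ℓ
    adj?       : Binary.Decidable Adj
    adj-sym    : Binary.Symmetric Adj
    adj-irrefl : ∀ {v} → ¬ Adj v v

  vertices : List Vertex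
  vertices = Finite.elements finite

  degree : Vertex → ℕ
  degree v = length (filter (adj? v) vertices)

open Graph using (Vertex; Adj; degree)

IsOddGraph : Graph → Set
IsOddGraph G = ∀ v → degree G v % 2 ≡ 1

induced : (G : Graph) (P : Pred (Vertex G) 0ℓ) → Decidable P → Irrelevant P → Graph
induced G P P? irr = record
  { Vertex     = Σ G.Vertex P
  ; finite     = Σ-finite P? irr G.finite
  ; Adj        = λ (u , _) (v , _) → G.Adj u v
  ; adj?       = λ (u , _) (v , _) → G.adj? u v
  ; adj-sym    = G.adj-sym
  ; adj-irrefl = G.adj-irrefl
  }
  where module G = Graph G

colourClass : (G : Graph) {k : ℕ} → (Vertex G → Fin k) → Fin k → Graph
colourClass G c i =
  induced G (λ v → c v ≡ i) (λ v → c v ≟ᶠ i) (Decidable⇒UIP.≡-irrelevant _≟ᶠ_)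

-- A partition of the vertex set into k parts is the family of fibres of a map
-- to Fin k; surjectivity says that the parts are nonempty.
record OddPartition (G : Graph) (k : ℕ) : Set where
  field
    part     : Vertex G → Fin k
    nonempty : StrictlySurjective _≡_ part
    odd      : ∀ i → IsOddGraph (colourClass G part i)

-- A relation rather than a function, because a graph need not have any odd
-- partition.
IsOddChromaticNumber : Graph → ℕ → Set
IsOddChromaticNumber G k = OddPartition G k × (∀ m → OddPartition G m → k ≤ m)

record IsSplit (G : Graph) : Set where
  field
    inClique    : Vertex G → Bool
    clique      : ∀ {u v} → inClique u ≡ true → inClique v ≡ true → u ≢ v → Adj G u v
    independent : ∀ {u v} → inClique u ≡ false → inClique v ≡ false → ¬ Adj G u v

path : ℕ → Graph
path m = record
  { Vertex     = Fin m
  ; finite     = Fin-finite m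
  ; Adj        = λ i j → suc (toℕ i) ≡ toℕ j ⊎ suc (toℕ j) ≡ toℕ i
  ; adj?       = λ i j → (suc (toℕ i) ≟ⁿ toℕ j) ⊎-dec (suc (toℕ j) ≟ⁿ toℕ i)
  ; adj-sym    = swap
  ; adj-irrefl = λ where
      (inj₁ eq) → 1+n≢n eq
      (inj₂ eq) → 1+n≢n eq
  }

record InducedCopy (F G : Graph) : Set where
  field
    embed     : Vertex F → Vertex G
    injective : Injective _≡_ _≡_ embed
    adj⇔      : ∀ u v → Adj F u v ⇔ Adj G (embed u) (embed v)

IsP₅Free : Graph → Set
IsP₅Free G = ¬ InducedCopy (path 5) G

-- An unordered pair of distinct elements, represented with its smaller
-- element first.
Pair : ℕ → Set
Pair n = Σ (Fin n × Fin n) λ (u , w) → u <ᶠ w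

H : ℕ → Graph
H n = record
  { Vertex     = V
  ; finite     = ⊎-finite (Fin-finite n)
                   (Σ-finite (λ (u , w) → u <ᶠ? w) <-irrelevant
                     (×-finite (Fin-finite n) (Fin-finite n)))
  ; Adj        = _~_
  ; adj?       = _~?_
  ; adj-sym    = λ {x} {y} → ~-sym x y
  ; adj-irrefl = λ {x} → ~-irrefl x
  }
  where
  V : Set
  V = Fin n ⊎ Pair n

  _~_ : Rel V 0ℓ
  inj₁ x             ~ inj₁ y             = x ≢ y
  inj₁ x             ~ inj₂ ((u , w) , _) = x ≡ u ⊎ x ≡ w
  inj₂ ((u , w) , _) ~ inj₁ x             = x ≡ u ⊎ x ≡ w
  inj₂ _             ~ inj₂ _             = ⊥

  _~?_ : Binary.Decidable _~_
  inj₁ x             ~? inj₁ y             = ¬? (x ≟ᶠ y)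
  inj₁ x             ~? inj₂ ((u , w) , _) = (x ≟ᶠ u) ⊎-dec (x ≟ᶠ w)
  inj₂ ((u , w) , _) ~? inj₁ x             = (x ≟ᶠ u) ⊎-dec (x ≟ᶠ w)
  inj₂ _             ~? inj₂ _             = no λ ()

  ~-sym : ∀ x y → x ~ y → y ~ x
  ~-sym (inj₁ _) (inj₁ _) = ≢-sym
  ~-sym (inj₁ _) (inj₂ _) = λ p → p
  ~-sym (inj₂ _) (inj₁ _) = λ p → p
  ~-sym (inj₂ _) (inj₂ _) = λ ()

  ~-irrefl : ∀ x → ¬ (x ~ x)
  ~-irrefl (inj₁ _) x≢x = x≢x refl
  ~-irrefl (inj₂ _) ()

OddChromaticNumberUnboundedOn : (Graph → Set) → Set₁
OddChromaticNumberUnboundedOn C =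
  ∀ (b : ℕ) → Σ Graph λ G → C G × ∃ λ k → IsOddChromaticNumber G k × b ≤ k

{-# OPTIONS --safe #-}

-- In an odd partition of H n the vertex attached to {u, w} has exactly one of
-- its two neighbours in its own part, so u and w lie in different parts; hence
-- the n clique vertices need n parts.  Conversely, a partition with one clique
-- vertex per part amounts to an orientation of K_n, each attached vertex joining
-- the part of one of its neighbours, and it is odd when every clique vertex
-- receives an odd number of attached vertices.  Giving each to its larger
-- neighbour yields the counts 0, 1, 2, ..., n - 1; the even ones are repaired by
-- reversing the pairs {4q, 4q + 2}, which all fit in when n ≡ 0 or 3 (mod 4).

module Submission where

open import Defs
open import Axiom.UniquenessOfIdentityProofs using (module Decidable⇒UIP)
open import Data.Bool using (Bool; true; false)
open import Data.Fin using (Fin; zero; suc; toℕ; fromℕ<; inject≤; punchIn; punchOut; #_) renaming (_<_ to _<ᶠ_)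
open import Data.Fin.Properties using (toℕ-injective; toℕ-fromℕ<; toℕ-inject≤; inject≤-injective; punchIn-injective; punchInᵢ≢i; punchIn-punchOut; toℕ<n; injective⇒≤; <-irrelevant; <-cmp; <⇒≢) renaming (_≟_ to _≟ᶠ_)
open import Data.List using (filter; tabulate)
open import Data.List.Membership.Propositional using (_∈_)
open import Data.List.Membership.Propositional.Properties using (∈-filter⁺; ∈-filter⁻; ∈-tabulate⁺; ∈-tabulate⁻)
open import Data.List.Membership.Propositional.Properties.WithK using (unique∧set⇒bag)
open import Data.List.Properties using (length-tabulate)
open import Data.List.Relation.Binary.BagAndSetEquality using (∼bag⇒↭)
open import Data.List.Relation.Binary.Permutation.Propositional.Properties using (↭-length)
import Data.List.Relation.Unary.Unique.Propositional.Properties as Unique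
open import Data.Nat using (ℕ; suc; _+_; _*_; _≤_; _<_; _%_) renaming (_≟_ to _≟ⁿ_)
open import Data.Nat.Divisibility using (_∣_; divides; _∣?_; ∣-trans; ∣m∣n⇒∣m+n; ∣-refl; _∣0; n∣m⇒m%n≡0)
open import Data.Nat.DivMod using (%-remove-+ʳ; m*n%n≡0)
open import Data.Nat.Properties using (<⇒≤; m≤m*n; m≤n⇒m<n∨m≡n; n<1+n; m<n⇒m<1+n; suc-injective)
open import Data.Product using (∃; _×_; _,_; proj₁; proj₂)
open import Data.Sum using (_⊎_; inj₁; inj₂)
open import Data.Sum.Properties using (inj₁-injective; inj₂-injective)
open import Function using (_∘_; case_of_)
open import Function.Bundles using (mk⇔; Equivalence)
open import Function.Definitions using (Injective)
open import Relation.Binary.Definitions using (tri<; tri≈; tri>)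
open import Relation.Binary.PropositionalEquality using (_≡_; _≢_; refl; sym; trans; cong; subst; module ≡-Reasoning)
open import Relation.Nullary using (¬_; Dec; yes; no; contradiction)
open import Relation.Nullary.Decidable using (_×-dec_)

-- Degrees from enumerated neighbourhoods

-- The filtered vertex list and `tabulate f` are both duplicate-free with the same members, so they
-- are permutations of each other and have equal length.
degree-enumerated : ∀ (G : Graph) (let open Graph G) v {d} (f : Fin d → Vertex) →
                    Injective _≡_ _≡_ f → (∀ j → Adj v (f j)) →
                    (∀ w → Adj v w → ∃ λ j → f j ≡ w) → degree v ≡ d
degree-enumerated G v f f-inj f-adj f-onto =
  trans (↭-length (∼bag⇒↭ (unique∧set⇒bag
          (Unique.filter⁺ (adj? v) (Finite.unique finite))
          (Unique.tabulate⁺ f-inj)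
          (mk⇔ to from))))
        (length-tabulate f)
  where
  open Graph G
  to : ∀ {w} → w ∈ filter (adj? v) vertices → w ∈ tabulate f
  to {w} w∈ with f-onto w (proj₂ (∈-filter⁻ (adj? v) {xs = vertices} w∈))
  ... | j , refl = ∈-tabulate⁺ j
  from : ∀ {w} → w ∈ tabulate f → w ∈ filter (adj? v) vertices
  from w∈ with ∈-tabulate⁻ w∈
  ... | j , refl = ∈-filter⁺ (adj? v) (Finite.complete finite (f j)) (f-adj j)

-- Equality proofs in `Fin k` are unique, so a vertex of a class is determined by its underlying
-- vertex and neighbours can be enumerated in `G` itself.
colourClass-degree : ∀ (G : Graph) (let open Graph G) {k} (c : Vertex → Fin k) {i v} (p : c v ≡ i)
                     {d} (f : Fin d → Vertex) → Injective _≡_ _≡_ f →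
                     (∀ j → c (f j) ≡ i × Adj v (f j)) →
                     (∀ w → c w ≡ i → Adj v w → ∃ λ j → f j ≡ w) →
                     Graph.degree (colourClass G c i) (v , p) ≡ d
colourClass-degree G c {i} {v} p f f-inj f-nbr f-onto =
  degree-enumerated (colourClass G c i) (v , p)
    (λ j → f j , proj₁ (f-nbr j)) (f-inj ∘ cong proj₁) (proj₂ ∘ f-nbr)
    λ (w , q) v~w → case f-onto w q v~w of λ where
      (j , refl) → j , cong (_ ,_) (Decidable⇒UIP.≡-irrelevant _≟ᶠ_ _ _)

module _ {n : ℕ} where
  open Graph (H n) using (Vertex; Adj)

  inj₂-≡ : ∀ {u u′ w w′ : Fin n} (u<w : u <ᶠ w) (u′<w′ : u′ <ᶠ w′) → u ≡ u′ → w ≡ w′ →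
           _≡_ {A = Vertex} (inj₂ ((u , w) , u<w)) (inj₂ ((u′ , w′) , u′<w′))
  inj₂-≡ p q refl refl = cong (λ r → inj₂ (_ , r)) (<-irrelevant p q)

-- Lower bound

  module _ {m : ℕ} (P : OddPartition (H n) m) where
    open OddPartition P

    -- If both ends shared a part, the attached vertex would have degree 2 inside that part or
    -- degree 0 outside it, and both are even.
    endpoints-separated : ∀ {u w} → u <ᶠ w → part (inj₁ u) ≢ part (inj₁ w)
    endpoints-separated {u} {w} u<w eq = separated (part s ≟ᶠ part (inj₁ u))
      where
      s : Vertex
      s = inj₂ ((u , w) , u<w)

      ends : Fin 2 → Vertex
      ends zero       = inj₁ u
      ends (suc zero) = inj₁ w

      ends-inj : Injective _≡_ _≡_ ends
      ends-inj {zero}     {zero}     _ = refl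
      ends-inj {zero}     {suc zero} p = contradiction (inj₁-injective p) (<⇒≢ u<w)
      ends-inj {suc zero} {zero}     p = contradiction (sym (inj₁-injective p)) (<⇒≢ u<w)
      ends-inj {suc zero} {suc zero} _ = refl

      -- Replaces the degree by a numeral, so that oddness of 2 or 0 is refuted by computation.
      odd-degree : ∀ {d} → Graph.degree (colourClass (H n) part (part s)) (s , refl) ≡ d → d % 2 ≡ 1
      odd-degree refl = odd (part s) (s , refl)

      separated : ¬ Dec (part s ≡ part (inj₁ u))
      separated (yes same) = case odd-degree (colourClass-degree (H n) part refl ends ends-inj
          (λ where
            zero       → sym same , inj₁ refl
            (suc zero) → sym (trans same eq) , inj₂ refl)
          (λ where
            (inj₁ x) _ (inj₁ refl) → zero , refl
            (inj₁ x) _ (inj₂ refl) → suc zero , refl))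
        of λ ()
      separated (no differ) = case odd-degree (colourClass-degree (H n) part refl {d = 0} (λ ()) (λ { {()} })
          (λ ())
          (λ where
            (inj₁ x) p (inj₁ refl) → contradiction (sym p) differ
            (inj₁ x) p (inj₂ refl) → contradiction (trans (sym p) (sym eq)) differ))
        of λ ()

    clique-injective : Injective _≡_ _≡_ (part ∘ inj₁)
    clique-injective {u} {w} eq with <-cmp u w
    ... | tri< u<w _ _ = contradiction eq (endpoints-separated u<w)
    ... | tri≈ _ u≡w _ = u≡w
    ... | tri> _ _ w<u = contradiction (sym eq) (endpoints-separated w<u)

    oddPartition-size : n ≤ m
    oddPartition-size = injective⇒≤ clique-injective

-- Parity

4∣⇒%2≡0 : ∀ {m} → 4 ∣ m → m % 2 ≡ 0
4∣⇒%2≡0 4∣m = n∣m⇒m%n≡0 _ 2 (∣-trans (divides 2 refl) 4∣m)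

4∣⇒suc%2≡1 : ∀ {m} → 4 ∣ m → suc m % 2 ≡ 1
4∣⇒suc%2≡1 4∣m = %-remove-+ʳ 1 {d = 2} (∣-trans (divides 2 refl) 4∣m)

-- One case for each fate of a count: a lower end of a reversed pair, an upper end, or neither. `≡2`
-- is indexed so as to expose the lower end of its pair.
data Residue : ℕ → Set where
  ≡0  : ∀ {m} → 4 ∣ m → Residue m
  ≡2  : ∀ {m} → 4 ∣ m → Residue (2 + m)
  odd : ∀ {m} → m % 2 ≡ 1 → Residue m

residue : ∀ m → Residue m
residue 0 = ≡0 (4 ∣0)
residue 1 = odd refl
residue 2 = ≡2 (4 ∣0)
residue 3 = odd refl
residue (suc (suc (suc (suc m)))) with residue m
... | ≡0 4∣m  = ≡0 (∣m∣n⇒∣m+n ∣-refl 4∣m)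
... | ≡2 4∣m  = ≡2 (∣m∣n⇒∣m+n ∣-refl 4∣m)
... | odd m%2 = odd m%2

-- Here the congruence on `n` enters: the partner of `m` is missing only if `n` is `1 + m` or
-- `2 + m`, that is, `n` has residue 1 or 2 modulo 4.
2+-below : ∀ {m n} → n % 4 ≡ 0 ⊎ n % 4 ≡ 3 → 4 ∣ m → m < n → 2 + m < n
2+-below {m} n%4 4∣m m<n with m≤n⇒m<n∨m≡n m<n
... | inj₂ refl = contradiction n%4 (λ where
        (inj₁ p) → case trans (sym p) (%-remove-+ʳ 1 4∣m) of λ ()
        (inj₂ p) → case trans (sym p) (%-remove-+ʳ 1 4∣m) of λ ())
... | inj₁ 1+m<n with m≤n⇒m<n∨m≡n 1+m<n
...   | inj₁ 2+m<n = 2+m<n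
...   | inj₂ refl = contradiction n%4 (λ where
        (inj₁ p) → case trans (sym p) (%-remove-+ʳ 2 4∣m) of λ ()
        (inj₂ p) → case trans (sym p) (%-remove-+ʳ 2 4∣m) of λ ())

-- Upper bound

-- These pairs are disjoint, so each reversal changes the count at its own two ends by one and
-- nowhere else.
Reversed : ∀ {n} → Fin n → Fin n → Set
Reversed u w = 4 ∣ toℕ u × toℕ w ≡ 2 + toℕ u

reversed? : ∀ {n} (u w : Fin n) → Dec (Reversed u w)
reversed? u w = (4 ∣? toℕ u) ×-dec (toℕ w ≟ⁿ 2 + toℕ u)

module _ {n : ℕ} where
  open Graph (H n) using (Vertex; Adj)

  owner : Vertex → Fin n
  owner (inj₁ x) = x
  owner (inj₂ ((u , w) , _)) with reversed? u w
  ... | yes _ = u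
  ... | no  _ = w

  -- The neighbours of clique vertex `x` within its own part, in a form that can be matched on
  -- without deciding `reversed?` again.
  data Owned (x : Fin n) : Vertex → Set where
    below : ∀ {y} (y<x : y <ᶠ x) → ¬ Reversed y x → Owned x (inj₂ ((y , x) , y<x))
    above : ∀ {w} (x<w : x <ᶠ w) → Reversed x w → Owned x (inj₂ ((x , w) , x<w))

  owned⇒neighbour : ∀ {x v} → Owned x v → owner v ≡ x × Adj (inj₁ x) v
  owned⇒neighbour {x} (below {y} _ ¬r) with reversed? y x
  ... | yes r = contradiction r ¬r
  ... | no  _ = refl , inj₂ refl
  owned⇒neighbour {x} (above {w} _ r) with reversed? x w
  ... | yes _ = refl , inj₁ refl
  ... | no ¬r = contradiction r ¬r

  neighbour⇒owned : ∀ {x} v → owner v ≡ x → Adj (inj₁ x) v → Owned x v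
  neighbour⇒owned (inj₁ y) p x≢y = contradiction (sym p) x≢y
  neighbour⇒owned (inj₂ ((u , w) , u<w)) p _ with reversed? u w | p
  ... | yes r | refl = above u<w r
  ... | no ¬r | refl = below u<w ¬r

  -- Part `i` contains just one clique vertex, `i` itself, and an attached vertex follows one of its
  -- own neighbours.
  leaf-degree : ∀ s {i} (p : owner (inj₂ s) ≡ i) →
                Graph.degree (colourClass (H n) owner i) (inj₂ s , p) ≡ 1
  leaf-degree s@((u , w) , u<w) refl =
    colourClass-degree (H n) owner refl (λ _ → inj₁ (owner (inj₂ s)))
      (λ { {zero} {zero} _ → refl })
      (λ _ → refl , adjacent)
      (λ { (inj₁ x) refl _ → zero , refl })
    where
    adjacent : Adj (inj₂ s) (inj₁ (owner (inj₂ s)))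
    adjacent with reversed? u w
    ... | yes _ = inj₁ refl
    ... | no  _ = inj₂ refl

  module _ (x : Fin n) where

    centre-degree : ∀ {d} (f : Fin d → Vertex) → Injective _≡_ _≡_ f →
                    (∀ j → Owned x (f j)) → (∀ {v} → Owned x v → ∃ λ j → f j ≡ v) →
                    Graph.degree (colourClass (H n) owner x) (inj₁ x , refl) ≡ d
    centre-degree f f-inj f-owned f-onto =
      colourClass-degree (H n) owner refl f f-inj (owned⇒neighbour ∘ f-owned)
        (λ v p x~v → f-onto (neighbour⇒owned v p x~v))

    -- Keeping `m` apart from `toℕ x` allows the form `2 + z` later, where one position has to be
    -- removed from `Fin m`.
    module _ {m} (x≡m : toℕ x ≡ m) where

      m≤n : m ≤ n
      m≤n = subst (_≤ n) x≡m (<⇒≤ (toℕ<n x))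

      smaller : Fin m → Fin n
      smaller j = inject≤ j m≤n

      smaller<x : ∀ j → smaller j <ᶠ x
      smaller<x j rewrite toℕ-inject≤ j m≤n | x≡m = toℕ<n j

      leaf : Fin m → Vertex
      leaf j = inj₂ ((smaller j , x) , smaller<x j)

      leaf-injective : Injective _≡_ _≡_ leaf
      leaf-injective eq =
        inject≤-injective m≤n m≤n _ _ (cong (proj₁ ∘ proj₁) (inj₂-injective eq))

      leaf-onto : ∀ {y} (y<x : y <ᶠ x) → ∃ λ j → leaf j ≡ inj₂ ((y , x) , y<x)
      leaf-onto {y} y<x = j , inj₂-≡ _ _ (toℕ-injective (trans (toℕ-inject≤ j m≤n) (toℕ-fromℕ< y<m))) refl
        where
        y<m = subst (toℕ y <_) x≡m y<x
        j   = fromℕ< y<m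

    -- Both ends of a reversed pair are even, so the original count stands.
    odd-centre : toℕ x % 2 ≡ 1 → Graph.degree (colourClass (H n) owner x) (inj₁ x , refl) ≡ toℕ x
    odd-centre x%2 = centre-degree (leaf refl) (leaf-injective refl)
      (λ j → below _ λ (4∣y , x≡2+y) →
        case trans (sym (4∣⇒%2≡0 4∣y)) (trans (cong (_% 2) (sym x≡2+y)) x%2) of λ ())
      λ where
        (below y<x _)       → leaf-onto refl y<x
        (above _ (4∣x , _)) → case trans (sym (4∣⇒%2≡0 4∣x)) x%2 of λ ()

    -- As a lower end, `x` gains the vertex attached to it and its partner `t`, and loses none.
    ≡0-centre : n % 4 ≡ 0 ⊎ n % 4 ≡ 3 → 4 ∣ toℕ x →
                Graph.degree (colourClass (H n) owner x) (inj₁ x , refl) ≡ suc (toℕ x)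
    ≡0-centre n%4 4∣x = centre-degree f f-inj f-owned f-onto
      where
      2+x<n = 2+-below n%4 4∣x (toℕ<n x)

      t : Fin n
      t = fromℕ< 2+x<n

      t≡2+x : toℕ t ≡ 2 + toℕ x
      t≡2+x = toℕ-fromℕ< 2+x<n

      x<t : x <ᶠ t
      x<t = subst (toℕ x <_) (sym t≡2+x) (m<n⇒m<1+n (n<1+n _))

      f : Fin (suc (toℕ x)) → Vertex
      f zero    = inj₂ ((x , t) , x<t)
      f (suc j) = leaf refl j

      x≢t : x ≢ t
      x≢t = <⇒≢ x<t

      f-inj : Injective _≡_ _≡_ f
      f-inj {zero}  {zero}  _  = refl
      f-inj {zero}  {suc j} eq = contradiction (cong (proj₂ ∘ proj₁) (inj₂-injective (sym eq))) x≢t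
      f-inj {suc i} {zero}  eq = contradiction (cong (proj₂ ∘ proj₁) (inj₂-injective eq)) x≢t
      f-inj {suc i} {suc j} eq = cong suc (leaf-injective refl eq)

      f-owned : ∀ j → Owned x (f j)
      f-owned zero    = above _ (4∣x , t≡2+x)
      -- An upper end has residue 2 modulo 4, whereas `x` has residue 0.
      f-owned (suc j) = below _ λ (4∣y , x≡2+y) →
        case trans (sym (%-remove-+ʳ 2 4∣y)) (trans (cong (_% 4) (sym x≡2+y)) (n∣m⇒m%n≡0 _ 4 4∣x)) of λ ()

      f-onto : ∀ {v} → Owned x v → ∃ λ j → f j ≡ v
      f-onto (below y<x _)         = case leaf-onto refl y<x of λ (j , eq) → suc j , eq
      f-onto (above _ (_ , w≡2+x)) =
        zero , inj₂-≡ _ _ refl (toℕ-injective (trans t≡2+x (sym w≡2+x)))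

    -- As an upper end, `x` loses exactly the vertex it shares with `z`, leaving one fewer than
    -- `2 + z`.
    ≡2-centre : ∀ {z} → toℕ x ≡ 2 + z → 4 ∣ z →
                Graph.degree (colourClass (H n) owner x) (inj₁ x , refl) ≡ suc z
    ≡2-centre {z} x≡2+z 4∣z = centre-degree f f-inj f-owned f-onto
      where
      z<2+z : z < 2 + z
      z<2+z = m<n⇒m<1+n (n<1+n z)

      -- The position of `z` among the smaller clique vertices, which `punchIn` skips.
      hole : Fin (2 + z)
      hole = fromℕ< z<2+z

      f : Fin (suc z) → Vertex
      f = leaf x≡2+z ∘ punchIn hole

      f-inj : Injective _≡_ _≡_ f
      f-inj = punchIn-injective hole _ _ ∘ leaf-injective x≡2+z

      reversed⇒hole : ∀ j → Reversed (smaller x≡2+z j) x → j ≡ hole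
      reversed⇒hole j (_ , x≡2+y) = toℕ-injective (begin
        toℕ j                   ≡⟨ toℕ-inject≤ j _ ⟨
        toℕ (smaller x≡2+z j)   ≡⟨ suc-injective (suc-injective (trans (sym x≡2+y) x≡2+z)) ⟩
        z                       ≡⟨ toℕ-fromℕ< z<2+z ⟨
        toℕ hole                ∎)
        where open ≡-Reasoning

      hole-reversed : Reversed (smaller x≡2+z hole) x
      hole-reversed = subst (4 ∣_) (sym hole≡z) 4∣z , trans x≡2+z (cong (2 +_) (sym hole≡z))
        where
        hole≡z : toℕ (smaller x≡2+z hole) ≡ z
        hole≡z = trans (toℕ-inject≤ hole _) (toℕ-fromℕ< z<2+z)

      f-owned : ∀ j → Owned x (f j)
      f-owned j = below _ (punchInᵢ≢i hole j ∘ reversed⇒hole (punchIn hole j))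

      f-onto : ∀ {v} → Owned x v → ∃ λ j → f j ≡ v
      f-onto (above _ (4∣x , _)) =
        case trans (sym (n∣m⇒m%n≡0 _ 4 4∣x)) (trans (cong (_% 4) x≡2+z) (%-remove-+ʳ 2 4∣z)) of λ ()
      f-onto (below y<x ¬r) with leaf-onto x≡2+z y<x
      ... | j , refl = punchOut hole≢j , cong (leaf x≡2+z) (punchIn-punchOut hole≢j)
        where
        hole≢j : hole ≢ j
        hole≢j refl = ¬r hole-reversed

    centre-odd : n % 4 ≡ 0 ⊎ n % 4 ≡ 3 →
                 Graph.degree (colourClass (H n) owner x) (inj₁ x , refl) % 2 ≡ 1
    centre-odd n%4 = go (residue (toℕ x)) refl
      where
      -- The index is generalised because `toℕ x` does not unify with the index `2 + m` of `≡2`.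
      go : ∀ {m} → Residue m → toℕ x ≡ m →
           Graph.degree (colourClass (H n) owner x) (inj₁ x , refl) % 2 ≡ 1
      go (≡0 4∣x)  refl  = trans (cong (_% 2) (≡0-centre n%4 4∣x)) (4∣⇒suc%2≡1 4∣x)
      go (≡2 4∣z)  x≡2+z = trans (cong (_% 2) (≡2-centre x≡2+z 4∣z)) (4∣⇒suc%2≡1 4∣z)
      go (odd x%2) refl  = trans (cong (_% 2) (odd-centre x%2)) x%2

  owner-oddPartition : n % 4 ≡ 0 ⊎ n % 4 ≡ 3 → OddPartition (H n) n
  owner-oddPartition n%4 = record
    { part     = owner
    ; nonempty = λ x → inj₁ x , refl
    ; odd      = λ where
        _ (inj₁ x , refl) → centre-odd x n%4
        i (inj₂ s , p)    → cong (_% 2) (leaf-degree s p)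
    }

H-oddChromaticNumber : ∀ n → n % 4 ≡ 0 ⊎ n % 4 ≡ 3 → IsOddChromaticNumber (H n) n
H-oddChromaticNumber n n%4 = owner-oddPartition n%4 , λ _ → oddPartition-size

-- Split graphs, induced paths and unboundedness

H-isSplit : ∀ n → IsSplit (H n)
H-isSplit n = record
  { inClique    = isInj₁?
  ; clique      = λ { {inj₁ _} {inj₁ _} _ _ u≢v → u≢v ∘ cong inj₁ }
  ; independent = λ { {inj₂ _} {inj₂ _} _ _ () }
  }
  where
  isInj₁? : Fin n ⊎ Pair n → Bool
  isInj₁? (inj₁ _) = true
  isInj₁? (inj₂ _) = false

-- Each of the edges v₀v₁ and v₃v₄ of an induced path has an endpoint in the
-- clique, yet no edge of the path joins the two.
split⇒P₅-free : ∀ G → IsSplit G → IsP₅Free G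
split⇒P₅-free G split copy = conflict (clique-end (# 0) (# 1) refl) (clique-end (# 3) (# 4) refl)
  where
  open IsSplit split
  open InducedCopy copy

  InClique : Fin 5 → Set
  InClique i = inClique (embed i) ≡ true

  clique-end : ∀ i j → suc (toℕ i) ≡ toℕ j → InClique i ⊎ InClique j
  clique-end i j i~j with inClique (embed i) in p | inClique (embed j) in q
  ... | true  | _     = inj₁ refl
  ... | false | true  = inj₂ refl
  ... | false | false = contradiction (Equivalence.to (adj⇔ i j) (inj₁ i~j)) (independent p q)

  far : ∀ {i j} → InClique i → InClique j → i ≢ j → ¬ ¬ Graph.Adj (path 5) i j
  far p q i≢j ¬i~j = ¬i~j (Equivalence.from (adj⇔ _ _) (clique p q (i≢j ∘ injective)))

  conflict : InClique (# 0) ⊎ InClique (# 1) → ¬ (InClique (# 3) ⊎ InClique (# 4))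
  conflict (inj₁ p) (inj₁ q) = far p q (λ ()) λ { (inj₁ ()) ; (inj₂ ()) }
  conflict (inj₁ p) (inj₂ q) = far p q (λ ()) λ { (inj₁ ()) ; (inj₂ ()) }
  conflict (inj₂ p) (inj₁ q) = far p q (λ ()) λ { (inj₁ ()) ; (inj₂ ()) }
  conflict (inj₂ p) (inj₂ q) = far p q (λ ()) λ { (inj₁ ()) ; (inj₂ ()) }

H-unbounded : ∀ (C : Graph → Set) → (∀ n → C (H n)) → OddChromaticNumberUnboundedOn C
H-unbounded C C-H b = H n , C-H n , n , H-oddChromaticNumber n (inj₁ (m*n%n≡0 b 4)) , m≤m*n b 4
  -- A multiple of 4 meets the congruence condition, and this one is at least `b`.
  where n = b * 4

mainTheorem10 : (∀ (n : ℕ) → 3 ≤ n → (n % 4 ≡ 0 ⊎ n % 4 ≡ 3) → IsOddChromaticNumber (H n) n × IsSplit (H n))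
    × OddChromaticNumberUnboundedOn IsSplit
    × OddChromaticNumberUnboundedOn IsP₅Free
mainTheorem10 =
    (λ n _ n%4 → H-oddChromaticNumber n n%4 , H-isSplit n)
  , H-unbounded IsSplit H-isSplit
  , H-unbounded IsP₅Free (λ n → split⇒P₅-free (H n) (H-isSplit n))
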